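{- For any prime $p\ge5$, any integer $\alpha\ge0$ and any integer $n\ge0$, \[ b_2\!\left(p^{2\alpha+1}n+\frac{(24j+1)p^{2\alpha}-1}{24}\right)\equiv 0 \pmod 2 \] for every integer $j$ with $0\le j\le p-1$ and $\left(\frac{24j+1}{p}\right)=-1$.
   Context: For a positive integer $\ell$, $b_\ell(n)$ denotes the number of partitions of $n$ having no part divisible by $\ell$. $\left(\frac{a}{p}\right)$ is the Legendre symbol. -}

module Defs where

open import Data.Fin.Base using (Fin; toℕ; fromℕ<)
import Data.Fin.Properties as Fin
open import Data.Integer.Base as ℤ using (ℤ; +_; 0ℤ; 1ℤ; -1ℤ)
import Data.Integer.DivMod as ℤ
import Data.Integer.Divisibility.Signed as ℤ
open import Data.Integer.Tactic.RingSolver using (solve-∀)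
open import Data.List.Base using (List; []; _∷_; length; filter; upTo; cartesianProductWith)
open import Data.List.Membership.Propositional using (_∈_)
open import Data.List.Membership.Propositional.Properties
  using (∈-cartesianProductWith⁺; ∈-cartesianProductWith⁻; ∈-upTo⁺; ∈-filter⁺; ∈-filter⁻)
open import Data.List.Properties using (∷-injective)
open import Data.List.Relation.Unary.All using (All; []; _∷_; all?; tabulate)
open import Data.List.Relation.Unary.AllPairs using ([]; _∷_)
open import Data.List.Relation.Unary.Any using (here; there)
open import Data.List.Relation.Unary.Linked using (Linked; linked?)
open import Data.List.Relation.Unary.Unique.Propositional using (Unique)
import Data.List.Relation.Unary.Unique.Propositional.Properties as Unique
open import Data.Nat.Base
open import Data.Nat.Divisibility using (_∣_; _∣?_)
open import Data.Nat.ListAction using (sum)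
open import Data.Nat.Primality using (Prime; prime⇒nonZero)
open import Data.Nat.Properties
open import Data.Product.Base using (_×_; _,_; proj₁; proj₂; ∃-syntax)
open import Function.Base using (_∘_; case_of_)
open import Relation.Binary.PropositionalEquality
open import Relation.Nullary.Decidable using (yes; no; map′; _×-dec_; ¬?)
open import Relation.Nullary.Negation using (¬_)
open import Relation.Unary using (Decidable)

record IsPartition (n : ℕ) (parts : List ℕ) : Set where
  constructor mkPartition
  field
    weaklyDecreasing : Linked _≥_ parts
    positive         : All (1 ≤_) parts
    sumsTo           : sum parts ≡ n

-- ℓ-regular partitions: those with no part divisible by ℓ.
record IsRegularPartition (ℓ n : ℕ) (parts : List ℕ) : Set where
  constructor mkRegular
  field
    isPartition : IsPartition n parts
    regular     : All (λ k → ¬ ℓ ∣ k) parts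

isPartition? : ∀ n → Decidable (IsPartition n)
isPartition? n parts =
  map′ (λ (d , p , s) → mkPartition d p s)
       (λ (mkPartition d p s) → d , p , s)
       (linked? _≥?_ parts ×-dec all? (1 ≤?_) parts ×-dec (sum parts ≟ n))

isRegularPartition? : ∀ ℓ n → Decidable (IsRegularPartition ℓ n)
isRegularPartition? ℓ n parts =
  map′ (λ (p , r) → mkRegular p r)
       (λ (mkRegular p r) → p , r)
       (isPartition? n parts ×-dec all? (¬? ∘ (ℓ ∣?_)) parts)

-- All lists of length at most k with entries at most n.
boundedLists : (k n : ℕ) → List (List ℕ)
boundedLists zero    n = [] ∷ []
boundedLists (suc k) n = [] ∷ cartesianProductWith _∷_ (upTo (suc n)) (boundedLists k n)

-- A partition of n has at most n parts, each at most n, so filtering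
-- boundedLists n n misses none; see ∈-regularPartitions⁺ and
-- regularPartitions-unique.
regularPartitions : (ℓ n : ℕ) → List (List ℕ)
regularPartitions ℓ n = filter (isRegularPartition? ℓ n) (boundedLists n n)

b : (ℓ : ℕ) .{{_ : NonZero ℓ}} → ℕ → ℕ
b ℓ n = length (regularPartitions ℓ n)

boundedLists-unique : ∀ k n → Unique (boundedLists k n)
boundedLists-unique zero    n = [] ∷ []
boundedLists-unique (suc k) n =
  nonEmpty ∷ Unique.cartesianProductWith⁺ _∷_ ∷-injective (Unique.upTo⁺ (suc n)) (boundedLists-unique k n)
  where
  nonEmpty : All (λ ys → [] ≢ ys) (cartesianProductWith _∷_ (upTo (suc n)) (boundedLists k n))
  nonEmpty = tabulate λ where
    ys∈ refl → case ∈-cartesianProductWith⁻ _∷_ (upTo (suc n)) (boundedLists k n) ys∈ of λ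
      { (_ , _ , _ , _ , ()) }

∈-boundedLists : ∀ k n xs → All (1 ≤_) xs → sum xs ≤ k → sum xs ≤ n → xs ∈ boundedLists k n
∈-boundedLists zero    n []       _          _   _   = here refl
∈-boundedLists zero    n (x ∷ xs) (1≤x ∷ _)  s≤0 _   with () ← ≤-trans 1≤x (≤-trans (m≤m+n x (sum xs)) s≤0)
∈-boundedLists (suc k) n []       _          _   _   = here refl
∈-boundedLists (suc k) n (x ∷ xs) (1≤x ∷ ps) s≤k s≤n = there
  (∈-cartesianProductWith⁺ _∷_
    (∈-upTo⁺ (s≤s (≤-trans (m≤m+n x (sum xs)) s≤n)))
    (∈-boundedLists k n xs ps
      (s≤s⁻¹ (≤-trans (+-monoˡ-≤ (sum xs) 1≤x) s≤k))
      (≤-trans (m≤n+m (sum xs) x) s≤n)))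

regularPartitions-unique : ∀ ℓ n → Unique (regularPartitions ℓ n)
regularPartitions-unique ℓ n =
  Unique.filter⁺ (isRegularPartition? ℓ n) (boundedLists-unique n n)

∈-regularPartitions⁺ : ∀ {ℓ n xs} → IsRegularPartition ℓ n xs → xs ∈ regularPartitions ℓ n
∈-regularPartitions⁺ {ℓ} {n} {xs} r@(mkRegular (mkPartition _ pos s≡n) _) =
  ∈-filter⁺ (isRegularPartition? ℓ n)
    (∈-boundedLists n n xs pos (≤-reflexive s≡n) (≤-reflexive s≡n)) r

∈-regularPartitions⁻ : ∀ {ℓ n xs} → xs ∈ regularPartitions ℓ n → IsRegularPartition ℓ n xs
∈-regularPartitions⁻ {ℓ} {n} xs∈ =
  proj₂ (∈-filter⁻ (isRegularPartition? ℓ n) {xs = boundedLists n n} xs∈)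

SquareMod : ℕ → ℤ → Set
SquareMod p a = ∃[ x ] (+ p) ℤ.∣ (x ℤ.* x ℤ.- a)

squareMod? : ∀ p .{{_ : NonZero p}} → Decidable (SquareMod p)
squareMod? p a =
  map′ (λ (i , p∣) → + toℕ i , p∣) reduce
       (Fin.any? {n = p} λ i → (+ p) ℤ.∣? ((+ toℕ i) ℤ.* (+ toℕ i) ℤ.- a))
  where
  shift : ∀ r q m a → (r ℤ.+ q ℤ.* m) ℤ.* (r ℤ.+ q ℤ.* m) ℤ.- a
                      ≡ (r ℤ.* r ℤ.- a) ℤ.+ ((+ 2) ℤ.* r ℤ.* q ℤ.+ q ℤ.* q ℤ.* m) ℤ.* m
  shift = solve-∀

  reduce : SquareMod p a → ∃[ i ] (+ p) ℤ.∣ ((+ toℕ {p} i) ℤ.* (+ toℕ i) ℤ.- a)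
  reduce (x , p∣) = fromℕ< (ℤ.n%ℕd<d x p) ,
    subst (λ r → (+ p) ℤ.∣ ((+ r) ℤ.* (+ r) ℤ.- a))
      (sym (Fin.toℕ-fromℕ< (ℤ.n%ℕd<d x p)))
      (ℤ.∣m+n∣n⇒∣m
        (subst ((+ p) ℤ.∣_) (shift (+ (x ℤ.%ℕ p)) (x ℤ./ℕ p) (+ p) a)
          (subst (λ y → (+ p) ℤ.∣ (y ℤ.* y ℤ.- a)) (ℤ.a≡a%ℕn+[a/ℕn]*n x p) p∣))
        (ℤ.∣n⇒∣m*n ((+ 2) ℤ.* (+ (x ℤ.%ℕ p)) ℤ.* (x ℤ./ℕ p) ℤ.+ (x ℤ./ℕ p) ℤ.* (x ℤ./ℕ p) ℤ.* (+ p))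
          ℤ.∣-refl))

legendre : (a : ℤ) (p : ℕ) {{_ : Prime p}} → ℤ
legendre a p {{p-prime}} with (+ p) ℤ.∣? a | squareMod? p {{prime⇒nonZero p-prime}} a
... | yes _ | _     = 0ℤ
... | no  _ | yes _ = 1ℤ
... | no  _ | no  _ = -1ℤ

{-# OPTIONS --safe #-}
-- Modulo 2 we have (1 + q^k)² = 1 + q^(2k), so the product E of all 1 + q^k is
-- the product of the 1 + q^(2i+1) times E².  Hence the generating function
-- 1/∏(1 + q^(2i+1)) of partitions into odd parts is E itself.  Shanks' finite
-- form of Euler's pentagonal number theorem shows that the coefficient of q^N
-- in E is even unless N is a generalised pentagonal number, in which case
-- 24 N + 1 is a square.  For the N of the theorem,
-- 24 N + 1 = p^(2α) (24 p n + 24 j + 1), so if b₂(N) were odd, 24 j + 1 would be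
-- a square modulo p.
module Submission where

open import Defs
open import Data.Integer.Base as ℤ using (+_; -1ℤ)
import Data.Integer.Divisibility.Signed as ℤ
import Data.Integer.Properties as ℤ
import Data.Integer.Tactic.RingSolver as ℤ-Solver
open import Data.List.Base using (List; []; _∷_; _++_; length; map)
open import Data.List.Membership.Propositional using (_∈_)
open import Data.List.Membership.Propositional.Properties using (∈-++⁺ˡ; ∈-++⁺ʳ; ∈-++⁻; ∈-map⁺; ∈-map⁻)
open import Data.List.Membership.Propositional.Properties.WithK using (unique∧set⇒bag)
open import Data.List.Properties using (length-++; length-map; ++-identityʳ; ∷-injectiveʳ)
open import Data.List.Relation.Binary.BagAndSetEquality using (∼bag⇒↭)
open import Data.List.Relation.Binary.Permutation.Propositional.Properties using (↭-length)
open import Data.List.Relation.Unary.All as All using (All; []; _∷_)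
open import Data.List.Relation.Unary.AllPairs using ([]; _∷_)
open import Data.List.Relation.Unary.Any using (here)
open import Data.List.Relation.Unary.Linked using (Linked; []; [-]; _∷_)
import Data.List.Relation.Unary.Linked as Linked
open import Data.List.Relation.Unary.Linked.Properties using (Linked⇒All)
open import Data.List.Relation.Unary.Unique.Propositional using (Unique)
import Data.List.Relation.Unary.Unique.Propositional.Properties as Unique
open import Data.Nat.Base using (ℕ; zero; suc; z≤n; s≤s; s≤s⁻¹; _+_; _*_; _∸_; _^_; _/_; _%_; _≤_; _<_; _≥_; NonZero; parity)
open import Data.Nat.Divisibility using (_∣_; divides; quotient; _∣?_; ∣m∣n⇒∣m+n; ∣m+n∣m⇒∣n; ∣n⇒∣m*n; ∣1⇒≡1)
open import Data.Nat.DivMod using (m*n/n≡m; m≡m%n+[m/n]*n; m%n<n; %-distribˡ-*)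
open import Data.Nat.Induction using (<-rec)
open import Data.Nat.ListAction using (sum)
open import Data.Nat.Primality using (Prime; prime⇒nonZero; prime⇒irreducible; euclidsLemma)
open import Data.Nat.Properties
open import Data.Nat.Tactic.RingSolver using (solve-∀)
open import Data.Parity.Base using (Parity; 0ℙ; 1ℙ) renaming (_+_ to _⊕_)
open import Data.Parity.Properties as ℙ using (p+p≡0ℙ; +-homo-+)
open import Algebra.Properties.CommutativeSemigroup ℙ.+-commutativeSemigroup using (xy∙z≈xz∙y) renaming (interchange to ⊕-interchange)
open import Data.Product.Base using (_×_; _,_; proj₁; ∃-syntax)
open import Data.Sum.Base using (_⊎_; inj₁; inj₂; reduce)
open import Function.Base using (_∘_)
open import Function.Bundles using (mk⇔)
open import Relation.Binary.PropositionalEquality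
open import Relation.Nullary.Decidable using (yes; no; from-yes; _⊎-dec_)
open import Relation.Nullary.Negation using (¬_; contradiction)

-- Power series over 𝔽₂

Series : Set
Series = ℕ → Parity

one : Series
one zero    = 1ℙ
one (suc _) = 0ℙ

-- Multiplication by q^k, with z in the vacated positions.
shift : ∀ {a} {A : Set a} → A → ℕ → (ℕ → A) → ℕ → A
shift z zero    f n       = f n
shift z (suc k) f zero    = z
shift z (suc k) f (suc n) = shift z k f n

module _ {a} {A : Set a} {z : A} where

  -- Coefficient n of a shifted series sees `f` only at the one m with k + m ≡ n. This lets
  -- inductions use agreement that is known below n only.
  shift-local : ∀ {f g : ℕ → A} k n → (∀ m → k + m ≡ n → f m ≡ g m) → shift z k f n ≡ shift z k g n
  shift-local zero    n       f≡g = f≡g n refl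
  shift-local (suc k) zero    f≡g = refl
  shift-local (suc k) (suc n) f≡g = shift-local k n λ m eq → f≡g m (cong suc eq)

  shift-cong : ∀ {f g : ℕ → A} k → f ≗ g → shift z k f ≗ shift z k g
  shift-cong k f≗g n = shift-local k n λ m _ → f≗g m

  shift-+ : ∀ (f : ℕ → A) k l → shift z (k + l) f ≗ shift z k (shift z l f)
  shift-+ f zero    l n       = refl
  shift-+ f (suc k) l zero    = refl
  shift-+ f (suc k) l (suc n) = shift-+ f k l n

  shift-< : ∀ (f : ℕ → A) {k n} → n < k → shift z k f n ≡ z
  shift-< f {suc k} {zero}  _         = refl
  shift-< f {suc k} {suc n} (s≤s n<k) = shift-< f n<k

  shift-homo : ∀ {b} {B : Set b} (h : A → B) (f : ℕ → A) k n → h (shift z k f n) ≡ shift (h z) k (h ∘ f) n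
  shift-homo h f zero    n       = refl
  shift-homo h f (suc k) zero    = refl
  shift-homo h f (suc k) (suc n) = shift-homo h f k n

shift-⊕ : ∀ f g k n → shift 0ℙ k (λ m → f m ⊕ g m) n ≡ shift 0ℙ k f n ⊕ shift 0ℙ k g n
shift-⊕ f g zero    n       = refl
shift-⊕ f g (suc k) zero    = refl
shift-⊕ f g (suc k) (suc n) = shift-⊕ f g k n

shift-one : ∀ k n → shift 0ℙ k one n ≡ 1ℙ → n ≡ k
shift-one zero    zero    _  = refl
shift-one (suc k) (suc n) eq = cong suc (shift-one k n eq)

-- Multiplication by 1 + q^k.
factor : ℕ → Series → Series
factor k f n = f n ⊕ shift 0ℙ k f n

factor-cong : ∀ {f g} k → f ≗ g → factor k f ≗ factor k g
factor-cong k f≗g n = cong₂ _⊕_ (f≗g n) (shift-cong k f≗g n)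

shift-factor : ∀ f k l n → shift 0ℙ k (factor l f) n ≡ shift 0ℙ k f n ⊕ shift 0ℙ (k + l) f n
shift-factor f k l n =
  trans (shift-⊕ f (shift 0ℙ l f) k n) (cong (shift 0ℙ k f n ⊕_) (sym (shift-+ f k l n)))

factor-comm : ∀ f k l → factor k (factor l f) ≗ factor l (factor k f)
factor-comm f k l n = begin
  (f n ⊕ shift 0ℙ l f n) ⊕ shift 0ℙ k (factor l f) n               ≡⟨ cong (factor l f n ⊕_) (shift-factor f k l n) ⟩
  (f n ⊕ shift 0ℙ l f n) ⊕ (shift 0ℙ k f n ⊕ shift 0ℙ (k + l) f n) ≡⟨ cong (λ i → factor l f n ⊕ (shift 0ℙ k f n ⊕ shift 0ℙ i f n)) (+-comm k l) ⟩
  (f n ⊕ shift 0ℙ l f n) ⊕ (shift 0ℙ k f n ⊕ shift 0ℙ (l + k) f n) ≡⟨ ⊕-interchange (f n) _ _ _ ⟩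
  (f n ⊕ shift 0ℙ k f n) ⊕ (shift 0ℙ l f n ⊕ shift 0ℙ (l + k) f n) ≡⟨ cong (factor k f n ⊕_) (shift-factor f l k n) ⟨
  factor l (factor k f) n                                          ∎
  where open ≡-Reasoning

-- In characteristic 2 the two cross terms `shift 0ℙ k f n` cancel.
factor-square : ∀ f k → factor k (factor k f) ≗ factor (k + k) f
factor-square f k n =
  trans (cong (factor k f n ⊕_) (shift-factor f k k n)) (cancel (f n) (shift 0ℙ k f n) _)
  where
  cancel : ∀ a b c → (a ⊕ b) ⊕ (b ⊕ c) ≡ a ⊕ c
  cancel a  0ℙ c  = cong (_⊕ c) (ℙ.+-identityʳ a)
  cancel 0ℙ 1ℙ 0ℙ = refl
  cancel 0ℙ 1ℙ 1ℙ = refl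
  cancel 1ℙ 1ℙ 0ℙ = refl
  cancel 1ℙ 1ℙ 1ℙ = refl

k+m≡n⇒m<n : ∀ {k m n} → suc k + m ≡ n → m < n
k+m≡n⇒m<n {k} {m} refl = s≤s (m≤n+m m k)

-- The exponent is positive, so coefficient n of the product is `f n` plus an earlier coefficient of
-- `f`, and strong induction recovers `f n`. The cut-off N is there because the later application
-- knows agreement in low degrees only.
factor-cancel : ∀ {f g} k N → (∀ n → n ≤ N → factor (suc k) f n ≡ factor (suc k) g n) →
                ∀ n → n ≤ N → f n ≡ g n
factor-cancel {f} {g} k N eq = <-rec (λ n → n ≤ N → f n ≡ g n) λ n rec n≤N →
  ℙ.+-cancelʳ-≡ (shift 0ℙ (suc k) g n) (f n) (g n)
    (trans
      (cong (f n ⊕_) (sym (shift-local (suc k) n λ m k+m≡n →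
        let m<n = k+m≡n⇒m<n k+m≡n in rec m<n (≤-trans (<⇒≤ m<n) n≤N))))
      (eq n n≤N))

-- Multiplication by the product of 1 + q^k over s < k ≤ s + d.
factors : ℕ → ℕ → Series → Series
factors s zero    f = f
factors s (suc d) f = factor (suc (s + d)) (factors s d f)

factors-cong : ∀ {f g} s d → f ≗ g → factors s d f ≗ factors s d g
factors-cong s zero    f≗g = f≗g
factors-cong s (suc d) f≗g = factor-cong (suc (s + d)) (factors-cong s d f≗g)

factors-factor : ∀ f s d k → factors s d (factor k f) ≗ factor k (factors s d f)
factors-factor f s zero    k n = refl
factors-factor f s (suc d) k n = trans
  (factor-cong (suc (s + d)) (factors-factor f s d k) n)
  (factor-comm (factors s d f) (suc (s + d)) k n)

-- `factors` peels off the largest exponent by definition; the telescoping below also needs the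
-- smallest, which commutes to the front.
factors-first : ∀ f s d → factors s (suc d) f ≗ factor (suc s) (factors (suc s) d f)
factors-first f s zero    n rewrite +-identityʳ s = refl
factors-first f s (suc d) n rewrite +-suc s d = trans
  (factor-cong (suc (suc (s + d))) (factors-first f s d) n)
  (factor-comm (factors (suc s) d f) (suc (suc (s + d))) (suc s) n)

-- Each extra factor 1 + q^k has k > s + d ≥ n, so it cannot reach degree n.
factors-stable : ∀ f s d e {n} → n ≤ s + d → factors s (d + e) f n ≡ factors s d f n
factors-stable f s d zero    n≤ rewrite +-identityʳ d = refl
factors-stable f s d (suc e) {n} n≤ rewrite +-suc d e = begin
  factors s (d + e) f n ⊕ shift 0ℙ (suc (s + (d + e))) (factors s (d + e) f) n
    ≡⟨ cong (factors s (d + e) f n ⊕_) (shift-< (factors s (d + e) f) (s≤s (≤-trans n≤ (+-monoʳ-≤ s (m≤m+n d e))))) ⟩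
  factors s (d + e) f n ⊕ 0ℙ  ≡⟨ ℙ.+-identityʳ _ ⟩
  factors s (d + e) f n       ≡⟨ factors-stable f s d e n≤ ⟩
  factors s d f n             ∎
  where open ≡-Reasoning

factors-cancel : ∀ {f g} s d N → (∀ n → n ≤ N → factors s d f n ≡ factors s d g n) →
                 ∀ n → n ≤ N → f n ≡ g n
factors-cancel s zero    N eq = eq
factors-cancel s (suc d) N eq = factors-cancel s d N (factor-cancel (s + d) N eq)

-- The inverse of the product over odd exponents

module _ (c : ℕ → Series) (c-zero : c 0 ≗ one) (c-suc : ∀ m → factor (suc (m + m)) (c (suc m)) ≗ c m) where

  -- Here `c m` stands for the inverse of the product of 1 + q^(2i+1) over i < m. Going from m to m
  -- + 1 adds two factors on the left: the one with exponent 2m+1 is absorbed by `c-suc`, and the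
  -- one with exponent 2m+2 is the square of 1 + q^(m+1).
  inverse-odd-factors-squared : ∀ m → factors 0 (m + m) (c m) ≗ factors 0 m (factors 0 m one)
  inverse-odd-factors-squared zero    n = c-zero n
  inverse-odd-factors-squared (suc m) n rewrite +-suc m m = begin
    factor 2m+2 (factor (suc (m + m)) (E (m + m) (c (suc m)))) n ≡⟨ factor-cong 2m+2 (factors-factor (c (suc m)) 0 (m + m) (suc (m + m))) n ⟨
    factor 2m+2 (E (m + m) (factor (suc (m + m)) (c (suc m)))) n ≡⟨ factor-cong 2m+2 (factors-cong 0 (m + m) (c-suc m)) n ⟩
    factor 2m+2 (E (m + m) (c m)) n                              ≡⟨ factor-cong 2m+2 (inverse-odd-factors-squared m) n ⟩
    factor 2m+2 (E m (E m one)) n                                ≡⟨ cong (λ k → factor (suc k) (E m (E m one)) n) (+-suc m m) ⟨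
    factor (suc m + suc m) (E m (E m one)) n                       ≡⟨ factor-square (E m (E m one)) (suc m) n ⟨
    factor (suc m) (factor (suc m) (E m (E m one))) n              ≡⟨ factor-cong (suc m) (factors-factor (E m one) 0 m (suc m)) n ⟨
    factor (suc m) (E m (factor (suc m) (E m one))) n              ∎
    where
    open ≡-Reasoning
    E = factors 0
    2m+2 = suc (suc (m + m))

  -- Up to degree m the 2m factors on the left of `inverse-odd-factors-squared` may be cut down to
  -- the first m, and then one copy of that product cancels from both sides.
  inverse-odd-factors : ∀ m n → n ≤ m → c m n ≡ factors 0 m one n
  inverse-odd-factors m = factors-cancel 0 m m λ n n≤m →
    trans (sym (factors-stable (c m) 0 m m n≤m)) (inverse-odd-factors-squared m n)

-- Shanks' identity

triangle : ℕ → ℕ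
triangle zero    = 0
triangle (suc n) = suc n + triangle n

partialSum : ℕ → (ℕ → Parity) → Parity
partialSum zero    t = 0ℙ
partialSum (suc m) t = partialSum m t ⊕ t m

-- The coefficient of q^x in the Shanks summand (-1)^s q^(sn + s(s+1)/2) times the product of 1 -
-- q^k over s < k ≤ n, with all signs dropped modulo 2.
shanksTerm : ℕ → ℕ → ℕ → Parity
shanksTerm x n s = shift 0ℙ (s * n + triangle s) (factors s (n ∸ s) one) x

shanks : ℕ → Series
shanks n x = partialSum (suc n) (shanksTerm x n)

-- The difference of consecutive finite forms telescopes over the upper limit m.
shanksTerm-telescope : ∀ x m d {n} → n ≡ m + d →
  partialSum (suc m) (shanksTerm x (suc n)) ⊕ partialSum (suc m) (shanksTerm x n)
    ≡ shift 0ℙ (suc m * suc n + triangle m) (factors m d one) x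
shanksTerm-telescope x zero d refl = begin
  (factors 0 d one x ⊕ shift 0ℙ (suc d) (factors 0 d one) x) ⊕ factors 0 d one x ≡⟨ cancel (factors 0 d one x) _ ⟩
  shift 0ℙ (suc d) (factors 0 d one) x                     ≡⟨ cong (λ k → shift 0ℙ k (factors 0 d one) x) (exponent d) ⟩
  shift 0ℙ (1 * suc d + 0) (factors 0 d one) x             ∎
  where
  open ≡-Reasoning
  cancel : ∀ a b → (a ⊕ b) ⊕ a ≡ b
  cancel 0ℙ 0ℙ = refl
  cancel 0ℙ 1ℙ = refl
  cancel 1ℙ 0ℙ = refl
  cancel 1ℙ 1ℙ = refl
  exponent : ∀ d → suc d ≡ 1 * suc d + 0
  exponent = solve-∀
shanksTerm-telescope x (suc m) d {n} refl = begin
  (S (suc n) ⊕ shanksTerm x (suc n) (suc m)) ⊕ (S n ⊕ shanksTerm x n (suc m))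
    ≡⟨ cong₂ (λ v w → (S (suc n) ⊕ v) ⊕ (S n ⊕ w)) term-suc term ⟩
  (S (suc n) ⊕ (P k ⊕ P (k + suc n))) ⊕ (S n ⊕ P l)
    ≡⟨ cancel (S (suc n)) (S n) (P l) (P k) (P (k + suc n)) previous ⟩
  P (k + suc n)
    ≡⟨ cong P (exponent₃ m n (triangle (suc m))) ⟩
  P (suc (suc m) * suc n + triangle (suc m))
    ∎
  where
  open ≡-Reasoning
  S = λ i → partialSum (suc m) (shanksTerm x i)
  k = suc m * suc n + triangle (suc m)
  l = suc m * n + triangle (suc m)
  P : ℕ → Parity
  P i = shift 0ℙ i (factors (suc m) d one) x
  exponent₁ : ∀ m n t → suc m * suc n + t ≡ suc m * n + (suc m + t)
  exponent₁ = solve-∀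
  exponent₂ : ∀ m n t → suc m * n + (suc m + t) + suc m ≡ suc m * suc n + (suc m + t)
  exponent₂ = solve-∀
  exponent₃ : ∀ m n t → suc m * suc n + t + suc n ≡ suc (suc m) * suc n + t
  exponent₃ = solve-∀
  term : shanksTerm x n (suc m) ≡ P l
  term = cong (λ e → shift 0ℙ l (factors (suc m) e one) x) (m+n∸m≡n (suc m) d)
  -- The product for n + 1 has one more factor than the product for n, namely 1 + q^(n+1), and this
  -- splits the term in two.
  term-suc : shanksTerm x (suc n) (suc m) ≡ P k ⊕ P (k + suc n)
  term-suc = begin
    shift 0ℙ k (factors (suc m) (n ∸ m) one) x
      ≡⟨ cong (λ e → shift 0ℙ k (factors (suc m) e one) x) (trans (cong (_∸ m) (sym (+-suc m d))) (m+n∸m≡n m (suc d))) ⟩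
    shift 0ℙ k (factors (suc m) (suc d) one) x
      ≡⟨ shift-factor (factors (suc m) d one) k (suc n) x ⟩
    P k ⊕ P (k + suc n) ∎
  -- The induction hypothesis has one factor too many, the smallest one, 1 + q^(m+1). Splitting it
  -- gives `P l`, which cancels the new term for n, and `P k`, which cancels one half of the new
  -- term for n + 1; only `P (k + suc n)` survives.
  previous : S (suc n) ⊕ S n ≡ P l ⊕ P k
  previous = begin
    S (suc n) ⊕ S n
      ≡⟨ shanksTerm-telescope x m (suc d) (sym (+-suc m d)) ⟩
    shift 0ℙ (suc m * suc n + triangle m) (factors m (suc d) one) x
      ≡⟨ cong (λ i → shift 0ℙ i (factors m (suc d) one) x) (exponent₁ m n (triangle m)) ⟩
    shift 0ℙ l (factors m (suc d) one) x
      ≡⟨ shift-cong l (factors-first one m d) x ⟩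
    shift 0ℙ l (factor (suc m) (factors (suc m) d one)) x
      ≡⟨ shift-factor (factors (suc m) d one) l (suc m) x ⟩
    P l ⊕ P (l + suc m)
      ≡⟨ cong (λ i → P l ⊕ P i) (exponent₂ m n (triangle m)) ⟩
    P l ⊕ P k ∎
  cancel : ∀ a b u v w → a ⊕ b ≡ u ⊕ v → (a ⊕ (v ⊕ w)) ⊕ (b ⊕ u) ≡ w
  cancel a b u v w eq = begin
    (a ⊕ (v ⊕ w)) ⊕ (b ⊕ u) ≡⟨ ⊕-interchange a (v ⊕ w) b u ⟩
    (a ⊕ b) ⊕ ((v ⊕ w) ⊕ u) ≡⟨ cong (_⊕ ((v ⊕ w) ⊕ u)) eq ⟩
    (u ⊕ v) ⊕ ((v ⊕ w) ⊕ u) ≡⟨ ⊕-interchange u v (v ⊕ w) u ⟩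
    (u ⊕ (v ⊕ w)) ⊕ (v ⊕ u) ≡⟨ cong ((u ⊕ (v ⊕ w)) ⊕_) (ℙ.+-comm v u) ⟩
    (u ⊕ (v ⊕ w)) ⊕ (u ⊕ v) ≡⟨ ⊕-interchange u (v ⊕ w) u v ⟩
    (u ⊕ u) ⊕ ((v ⊕ w) ⊕ v) ≡⟨ cong₂ _⊕_ (p+p≡0ℙ u) (trans (cong (_⊕ v) (ℙ.+-comm v w)) (ℙ.+-assoc w v v)) ⟩
    w ⊕ (v ⊕ v)             ≡⟨ cong (w ⊕_) (p+p≡0ℙ v) ⟩
    w ⊕ 0ℙ                  ≡⟨ ℙ.+-identityʳ w ⟩
    w                       ∎

-- The first monomial is the telescoped sum at m = n, where the product is empty; the second is the
-- extra summand s = n + 1. With k = n + 1 the exponents are the pentagonal numbers k(3k-1)/2 and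
-- k(3k+1)/2.
shanks-suc : ∀ n x → shanks (suc n) x ⊕ shanks n x
                   ≡ shift 0ℙ (suc n * suc n + triangle n) one x ⊕ shift 0ℙ (suc n * suc n + triangle (suc n)) one x
shanks-suc n x = begin
  (S ⊕ shanksTerm x (suc n) (suc n)) ⊕ shanks n x ≡⟨ cong (λ e → (S ⊕ shift 0ℙ k (factors (suc n) e one) x) ⊕ shanks n x) (n∸n≡0 n) ⟩
  (S ⊕ T) ⊕ shanks n x                            ≡⟨ xy∙z≈xz∙y S T (shanks n x) ⟩
  (S ⊕ shanks n x) ⊕ T                            ≡⟨ cong (_⊕ T) (shanksTerm-telescope x n 0 (sym (+-identityʳ n))) ⟩
  shift 0ℙ (suc n * suc n + triangle n) one x ⊕ T ∎
  where
  open ≡-Reasoning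
  S = partialSum (suc n) (shanksTerm x (suc n))
  k = suc n * suc n + triangle (suc n)
  T = shift 0ℙ k one x

-- Generalised pentagonal numbers and squares

triangle-double : ∀ n → triangle n + triangle n ≡ n * suc n
triangle-double zero    = refl
triangle-double (suc n) = begin
  (suc n + triangle n) + (suc n + triangle n) ≡⟨ rearrange n (triangle n) ⟩
  suc n + suc n + (triangle n + triangle n)   ≡⟨ cong (λ t → suc n + suc n + t) (triangle-double n) ⟩
  suc n + suc n + n * suc n                   ≡⟨ expand n ⟩
  suc n * suc (suc n)                         ∎
  where
  open ≡-Reasoning
  rearrange : ∀ n t → (suc n + t) + (suc n + t) ≡ suc n + suc n + (t + t)
  rearrange = solve-∀
  expand : ∀ n → suc n + suc n + n * suc n ≡ suc n * suc (suc n)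
  expand = solve-∀

-- With k = n + 1 the pentagonal number is k(3k-1)/2, and 6n + 5 is 6k - 1.
pentagonal⁻-square : ∀ n → (6 * n + 5) * (6 * n + 5) ≡ 24 * (suc n * suc n + triangle n) + 1
pentagonal⁻-square n = sym (begin
  24 * (suc n * suc n + triangle n) + 1                     ≡⟨ rearrange n (triangle n) ⟩
  24 * (suc n * suc n) + 12 * (triangle n + triangle n) + 1 ≡⟨ cong (λ t → 24 * (suc n * suc n) + 12 * t + 1) (triangle-double n) ⟩
  24 * (suc n * suc n) + 12 * (n * suc n) + 1               ≡⟨ expand n ⟩
  (6 * n + 5) * (6 * n + 5)                                 ∎)
  where
  open ≡-Reasoning
  rearrange : ∀ n t → 24 * (suc n * suc n + t) + 1 ≡ 24 * (suc n * suc n) + 12 * (t + t) + 1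
  rearrange = solve-∀
  expand : ∀ n → 24 * (suc n * suc n) + 12 * (n * suc n) + 1 ≡ (6 * n + 5) * (6 * n + 5)
  expand = solve-∀

pentagonal⁺-square : ∀ n → (6 * n + 1) * (6 * n + 1) ≡ 24 * (n * n + triangle n) + 1
pentagonal⁺-square n = sym (begin
  24 * (n * n + triangle n) + 1                     ≡⟨ rearrange n (triangle n) ⟩
  24 * (n * n) + 12 * (triangle n + triangle n) + 1 ≡⟨ cong (λ t → 24 * (n * n) + 12 * t + 1) (triangle-double n) ⟩
  24 * (n * n) + 12 * (n * suc n) + 1               ≡⟨ expand n ⟩
  (6 * n + 1) * (6 * n + 1)                         ∎)
  where
  open ≡-Reasoning
  rearrange : ∀ n t → 24 * (n * n + t) + 1 ≡ 24 * (n * n) + 12 * (t + t) + 1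
  rearrange = solve-∀
  expand : ∀ n → 24 * (n * n) + 12 * (n * suc n) + 1 ≡ (6 * n + 1) * (6 * n + 1)
  expand = solve-∀

⊕-odd-summand : ∀ a b c d → a ⊕ b ≡ c ⊕ d → a ≡ 1ℙ → b ≡ 1ℙ ⊎ c ≡ 1ℙ ⊎ d ≡ 1ℙ
⊕-odd-summand a  1ℙ c  d  _  _ = inj₁ refl
⊕-odd-summand a  0ℙ 1ℙ d  _  _ = inj₂ (inj₁ refl)
⊕-odd-summand a  0ℙ 0ℙ 1ℙ _  _ = inj₂ (inj₂ refl)
⊕-odd-summand 1ℙ 0ℙ 0ℙ 0ℙ () _

-- `shanks 0` is the series 1, and each step adds two pentagonal monomials, so an odd coefficient
-- can only sit at one of these exponents.
shanks-support : ∀ n x → shanks n x ≡ 1ℙ → ∃[ y ] y * y ≡ 24 * x + 1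
shanks-support zero    x eq with refl ← shift-one 0 x eq = 1 , refl
shanks-support (suc n) x eq
  with ⊕-odd-summand (shanks (suc n) x) (shanks n x) _ _ (shanks-suc n x) eq
... | inj₁ eq′ = shanks-support n x eq′
... | inj₂ (inj₁ eq′) with refl ← shift-one (suc n * suc n + triangle n) x eq′ = 6 * n + 5 , pentagonal⁻-square n
... | inj₂ (inj₂ eq′) with refl ← shift-one (suc n * suc n + triangle (suc n)) x eq′ = 6 * suc n + 1 , pentagonal⁺-square (suc n)

-- A summand with s ≥ 1 starts in degree sn + s(s+1)/2 > n, so only s = 0 contributes, and that is
-- the full product.
shanks-≤ : ∀ {n x} → x ≤ n → shanks n x ≡ factors 0 n one x
shanks-≤ {n} {x} x≤n = first-only n
  where
  first-only : ∀ m → partialSum (suc m) (shanksTerm x n) ≡ factors 0 n one x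
  first-only zero    = refl
  first-only (suc m) = trans
    (cong₂ _⊕_ (first-only m) (shift-< (factors (suc m) (n ∸ suc m) one) (begin-strict
      x                                    ≤⟨ x≤n ⟩
      n                                    ≤⟨ m≤m+n n (m * n) ⟩
      suc m * n                            <⟨ m<m+n (suc m * n) (s≤s z≤n) ⟩
      suc m * n + triangle (suc m)         ∎)))
    (ℙ.+-identityʳ _)
    where open ≤-Reasoning

-- Partitions into odd parts

-- The partitions of n ≤ fuel into odd parts less than 2 m.
oddPartitions : (fuel m n : ℕ) → List (List ℕ)
oddPartitions fuel       zero    zero    = [] ∷ []
oddPartitions fuel       zero    (suc _) = []
oddPartitions zero       (suc m) n       = oddPartitions zero m n
oddPartitions (suc fuel) (suc m) n       =
  oddPartitions (suc fuel) m n ++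
  shift [] (suc (m + m)) (λ k → map (suc (m + m) ∷_) (oddPartitions fuel (suc m) k)) n

-- Every part used lowers n by at least 1, so any fuel that is at least n suffices. This reconciles
-- the fuel left over in a recursive call with `oddCount`, where the fuel is the number being
-- partitioned.
oddPartitions-fuel : ∀ f g m n → n ≤ f → n ≤ g → oddPartitions f m n ≡ oddPartitions g m n
oddPartitions-fuel f       g       zero    zero    _   _   = refl
oddPartitions-fuel f       g       zero    (suc n) _   _   = refl
oddPartitions-fuel zero    zero    (suc m) n       _   _   = refl
oddPartitions-fuel zero    (suc g) (suc m) zero    _   _   =
  trans (oddPartitions-fuel zero (suc g) m zero z≤n z≤n) (sym (++-identityʳ _))
oddPartitions-fuel (suc f) zero    (suc m) zero    _   _   =
  trans (++-identityʳ _) (oddPartitions-fuel (suc f) zero m zero z≤n z≤n)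
oddPartitions-fuel (suc f) (suc g) (suc m) n       n≤f n≤g = cong₂ _++_
  (oddPartitions-fuel (suc f) (suc g) m n n≤f n≤g)
  (shift-local (suc (m + m)) n λ k eq →
    let k<n = k+m≡n⇒m<n eq in
    cong (map _) (oddPartitions-fuel f g (suc m) k (s≤s⁻¹ (≤-trans k<n n≤f)) (s≤s⁻¹ (≤-trans k<n n≤g))))

oddCount : ℕ → Series
oddCount m n = parity (length (oddPartitions n m n))

oddCount-zero : oddCount 0 ≗ one
oddCount-zero zero    = refl
oddCount-zero (suc n) = refl

-- A partition into odd parts below 2m+2 either has no part 2m+1 or is such a partition with a 2m+1
-- put in front. Modulo 2 the second count moves to the other side.
oddCount-suc : ∀ m → factor (suc (m + m)) (oddCount (suc m)) ≗ oddCount m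
oddCount-suc m zero    = ℙ.+-identityʳ _
oddCount-suc m (suc n) = begin
  parity (length (L ++ M)) ⊕ R                ≡⟨ cong (λ l → parity l ⊕ R) (length-++ L) ⟩
  parity (length L + length M) ⊕ R            ≡⟨ cong (_⊕ R) (+-homo-+ (length L) (length M)) ⟩
  (parity (length L) ⊕ parity (length M)) ⊕ R ≡⟨ cong (λ r → (parity (length L) ⊕ r) ⊕ R) M≡R ⟩
  (parity (length L) ⊕ R) ⊕ R                 ≡⟨ ℙ.+-assoc (parity (length L)) R R ⟩
  parity (length L) ⊕ (R ⊕ R)                 ≡⟨ cong (parity (length L) ⊕_) (p+p≡0ℙ R) ⟩
  parity (length L) ⊕ 0ℙ                      ≡⟨ ℙ.+-identityʳ _ ⟩
  parity (length L)                           ∎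
  where
  open ≡-Reasoning
  L = oddPartitions (suc n) m (suc n)
  M = shift [] (suc (m + m)) (λ k → map (suc (m + m) ∷_) (oddPartitions n (suc m) k)) (suc n)
  R = shift 0ℙ (suc (m + m)) (oddCount (suc m)) (suc n)
  -- The empty list in the vacated positions has even length, and prefixing a part keeps the number
  -- of lists.
  M≡R : parity (length M) ≡ R
  M≡R = trans
    (shift-homo (parity ∘ length) (λ k → map (suc (m + m) ∷_) (oddPartitions n (suc m) k)) (suc (m + m)) (suc n))
    (shift-local (suc (m + m)) (suc n) λ k eq → cong parity (trans
      (length-map _ (oddPartitions n (suc m) k))
      (cong length (oddPartitions-fuel n k (suc m) k (s≤s⁻¹ (k+m≡n⇒m<n eq)) ≤-refl))))

-- The enumeration by odd parts agrees with `b 2`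

2∣m+m : ∀ m → 2 ∣ m + m
2∣m+m m = divides m (trans (cong (λ k → m + k) (sym (+-identityʳ m))) (*-comm 2 m))

2∤1+m+m : ∀ m → ¬ 2 ∣ suc (m + m)
2∤1+m+m m 2∣ with () ← ∣1⇒≡1 (∣m+n∣m⇒∣n (subst (2 ∣_) (+-comm 1 (m + m)) 2∣) (2∣m+m m))

∈-shift⁻ : ∀ {a} {A : Set a} {x : A} (f : ℕ → List A) k n →
           x ∈ shift [] k f n → ∃[ m ] k + m ≡ n × x ∈ f m
∈-shift⁻ f zero    n       x∈ = n , refl , x∈
∈-shift⁻ f (suc k) (suc n) x∈ with m , eq , x∈f ← ∈-shift⁻ f k n x∈ = m , cong suc eq , x∈f

shift-+ˡ : ∀ {a} {A : Set a} (z : A) (f : ℕ → A) k n → shift z k f (k + n) ≡ f n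
shift-+ˡ z f zero    n = refl
shift-+ˡ z f (suc k) n = shift-+ˡ z f k n

shift-preserves : ∀ {a p} {A : Set a} (P : A → Set p) {z : A} {f : ℕ → A} k n →
                  P z → (∀ m → P (f m)) → P (shift z k f n)
shift-preserves P zero    n       Pz Pf = Pf n
shift-preserves P (suc k) zero    Pz Pf = Pz
shift-preserves P (suc k) (suc n) Pz Pf = shift-preserves P k n Pz Pf

m+m<1+m+1+m : ∀ m → m + m < suc m + suc m
m+m<1+m+1+m m = s≤s (+-monoʳ-≤ m (n≤1+n m))

-- The bound on the parts is carried through the induction because it shows that a prefixed part
-- 2m+1 keeps the list weakly decreasing.
∈-oddPartitions⁻ : ∀ f m n {xs} → xs ∈ oddPartitions f m n → IsRegularPartition 2 n xs × All (_< m + m) xs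
∈-oddPartitions⁻ f zero zero (here refl) = mkRegular (mkPartition [] [] refl) [] , []
∈-oddPartitions⁻ zero (suc m) n xs∈ with r , xs< ← ∈-oddPartitions⁻ zero m n xs∈ =
  r , All.map (λ x< → <-trans x< (m+m<1+m+1+m m)) xs<
∈-oddPartitions⁻ (suc f) (suc m) n xs∈ with ∈-++⁻ (oddPartitions (suc f) m n) xs∈
... | inj₁ xs∈ˡ with r , xs< ← ∈-oddPartitions⁻ (suc f) m n xs∈ˡ =
  r , All.map (λ x< → <-trans x< (m+m<1+m+1+m m)) xs<
... | inj₂ xs∈ʳ
  with k , refl , xs∈map ← ∈-shift⁻ _ (suc (m + m)) n xs∈ʳ
  with ys , ys∈ , refl ← ∈-map⁻ (suc (m + m) ∷_) xs∈map
  with mkRegular (mkPartition d p refl) r , ys< ← ∈-oddPartitions⁻ f (suc m) k ys∈ =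
    mkRegular (mkPartition (cons-linked ys< d) (s≤s z≤n ∷ p) refl) (2∤1+m+m m ∷ r)
  , s≤s (≤-reflexive (sym (+-suc m m))) ∷ ys<
  where
  cons-linked : ∀ {ys} → All (_< suc m + suc m) ys → Linked _≥_ ys → Linked _≥_ (suc (m + m) ∷ ys)
  cons-linked []         []  = [-]
  cons-linked (y< ∷ ys<) lnk = ≤-trans (s≤s⁻¹ y<) (≤-reflexive (+-suc m m)) ∷ lnk

odd-<-split : ∀ {m x} → ¬ 2 ∣ x → x < suc m + suc m → x ≡ suc (m + m) ⊎ x < m + m
odd-<-split {m} {x} odd x< with m≤n⇒m<n∨m≡n (≤-trans (s≤s⁻¹ x<) (≤-reflexive (+-suc m m)))
... | inj₂ x≡ = inj₁ x≡
... | inj₁ x<1+m+m = inj₂ (≤∧≢⇒< (s≤s⁻¹ x<1+m+m) λ { refl → odd (2∣m+m m) })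

-- The head is the largest part. If it equals 2m+1, it is removed; otherwise it is below 2m, and by
-- monotonicity so are all the others.
∈-oddPartitions⁺ : ∀ f m n {xs} → n ≤ f → IsRegularPartition 2 n xs → All (_< m + m) xs → xs ∈ oddPartitions f m n
∈-oddPartitions⁺ f zero n n≤f (mkRegular (mkPartition _ _ refl) _) [] = here refl
∈-oddPartitions⁺ zero (suc m) n z≤n r [] = ∈-oddPartitions⁺ zero m n z≤n r []
∈-oddPartitions⁺ zero (suc m) n z≤n (mkRegular (mkPartition _ (s≤s _ ∷ _) ()) _) (_ ∷ _)
∈-oddPartitions⁺ (suc f) (suc m) n n≤f r [] = ∈-++⁺ˡ (∈-oddPartitions⁺ (suc f) m n n≤f r [])
∈-oddPartitions⁺ (suc f) (suc m) n {x ∷ xs} n≤f r@(mkRegular (mkPartition d (_ ∷ ps) refl) (o ∷ os)) (x< ∷ xs<)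
  with odd-<-split {m} o x<
... | inj₁ refl = ∈-++⁺ʳ (oddPartitions (suc f) m n)
  (subst (_ ∈_) (sym (shift-+ˡ [] _ (suc (m + m)) (sum xs)))
    (∈-map⁺ (suc (m + m) ∷_)
      (∈-oddPartitions⁺ f (suc m) (sum xs)
        (≤-trans (m≤n+m (sum xs) (m + m)) (s≤s⁻¹ n≤f))
        (mkRegular (mkPartition (Linked.tail d) ps refl) os)
        xs<)))
... | inj₂ x<m+m = ∈-++⁺ˡ (∈-oddPartitions⁺ (suc f) m n n≤f r
  (All.map (λ y≤x → ≤-<-trans y≤x x<m+m) (Linked⇒All (λ i≥j j≥k → ≤-trans j≥k i≥j) ≤-refl d)))

oddPartitions-unique : ∀ f m n → Unique (oddPartitions f m n)
oddPartitions-unique f       zero    zero    = [] ∷ []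
oddPartitions-unique f       zero    (suc n) = []
oddPartitions-unique zero    (suc m) n       = oddPartitions-unique zero m n
oddPartitions-unique (suc f) (suc m) n       = Unique.++⁺
  (oddPartitions-unique (suc f) m n)
  (shift-preserves Unique (suc (m + m)) n [] λ k → Unique.map⁺ ∷-injectiveʳ (oddPartitions-unique f (suc m) k))
  disjoint
  where
  -- Lists on the left have all parts below 2m, while those on the right begin with 2m+1.
  disjoint : ∀ {xs} → ¬ (xs ∈ oddPartitions (suc f) m n ×
    xs ∈ shift [] (suc (m + m)) (λ k → map (suc (m + m) ∷_) (oddPartitions f (suc m) k)) n)
  disjoint (xs∈ˡ , xs∈ʳ)
    with k , _ , xs∈map ← ∈-shift⁻ _ (suc (m + m)) n xs∈ʳ
    with ys , _ , refl ← ∈-map⁻ (suc (m + m) ∷_) xs∈map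
    with _ , (1+m+m< ∷ _) ← ∈-oddPartitions⁻ (suc f) m n xs∈ˡ
    = contradiction 1+m+m< (≤⇒≯ (n≤1+n (m + m)))

parts≤sum : ∀ xs → All (_≤ sum xs) xs
parts≤sum []       = []
parts≤sum (x ∷ xs) = m≤m+n x (sum xs) ∷ All.map (λ y≤ → ≤-trans y≤ (m≤n+m (sum xs) x)) (parts≤sum xs)

-- Two duplicate-free lists with the same members are permutations of each other. The bound m = n is
-- large enough: a part x satisfies 1 ≤ x ≤ n, hence x < 2n.
b₂≡length-oddPartitions : ∀ n → b 2 n ≡ length (oddPartitions n n n)
b₂≡length-oddPartitions n = ↭-length (∼bag⇒↭ (unique∧set⇒bag
  (regularPartitions-unique 2 n)
  (oddPartitions-unique n n n)
  (mk⇔ (to ∘ ∈-regularPartitions⁻) (∈-regularPartitions⁺ ∘ proj₁ ∘ ∈-oddPartitions⁻ n n n))))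
  where
  to : ∀ {xs} → IsRegularPartition 2 n xs → xs ∈ oddPartitions n n n
  to {xs} r@(mkRegular (mkPartition _ pos refl) _) = ∈-oddPartitions⁺ n n n ≤-refl r
    (All.zipWith (λ (1≤x , x≤n) → +-mono-≤ (≤-trans 1≤x x≤n) x≤n) (pos , parts≤sum xs))

-- The parity of `b 2 n`

parity≡0⇒even : ∀ n → parity n ≡ 0ℙ → n % 2 ≡ 0
parity≡0⇒even zero          _  = refl
parity≡0⇒even (suc (suc n)) eq = parity≡0⇒even n eq

b₂-even : ∀ n → (∀ y → y * y ≢ 24 * n + 1) → b 2 n % 2 ≡ 0
b₂-even n nonsquare = parity≡0⇒even (b 2 n) (≢1⇒≡0 λ odd →
  let y , eq = shanks-support n n (trans (sym coefficient) odd) in nonsquare y eq)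
  where
  ≢1⇒≡0 : ∀ {a} → a ≢ 1ℙ → a ≡ 0ℙ
  ≢1⇒≡0 {0ℙ} _   = refl
  ≢1⇒≡0 {1ℙ} 1≢1 = contradiction refl 1≢1
  coefficient : parity (b 2 n) ≡ shanks n n
  coefficient = begin
    parity (b 2 n)     ≡⟨ cong parity (b₂≡length-oddPartitions n) ⟩
    oddCount n n       ≡⟨ inverse-odd-factors oddCount oddCount-zero oddCount-suc n n ≤-refl ⟩
    factors 0 n one n  ≡⟨ shanks-≤ {n} ≤-refl ⟨
    shanks n n         ∎
    where open ≡-Reasoning

-- Arithmetic of the progression

-- Every unit modulo 24 squares to 1; this is decided residue by residue.
square-mod-24 : ∀ r → r < 24 → 2 ∣ r ⊎ 3 ∣ r ⊎ r * r % 24 ≡ 1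
square-mod-24 r = from-yes (allUpTo? (λ r → 2 ∣? r ⊎-dec 3 ∣? r ⊎-dec r * r % 24 ≟ 1) 24)

prime∤ : ∀ {d p} → Prime p → d ≢ 1 → d < p → ¬ d ∣ p
prime∤ p-prime d≢1 d<p d∣p with prime⇒irreducible p-prime d∣p
... | inj₁ d≡1 = d≢1 d≡1
... | inj₂ d≡p = <⇒≢ d<p d≡p

∣%⇒∣ : ∀ {d} m n .{{_ : NonZero n}} → d ∣ n → d ∣ m % n → d ∣ m
∣%⇒∣ {d} m n d∣n d∣m%n =
  subst (d ∣_) (sym (m≡m%n+[m/n]*n m n)) (∣m∣n⇒∣m+n d∣m%n (∣n⇒∣m*n (m / n) d∣n))

prime²≡1+24t : ∀ {p} → Prime p → 5 ≤ p → ∃[ t ] p ^ 2 ≡ 1 + 24 * t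
prime²≡1+24t {p} p-prime 5≤p with square-mod-24 (p % 24) (m%n<n p 24)
... | inj₁ 2∣r = contradiction (∣%⇒∣ p 24 (divides 12 refl) 2∣r)
  (prime∤ p-prime (λ ()) (≤-trans (from-yes (3 ≤? 5)) 5≤p))
... | inj₂ (inj₁ 3∣r) = contradiction (∣%⇒∣ p 24 (divides 8 refl) 3∣r)
  (prime∤ p-prime (λ ()) (≤-trans (from-yes (4 ≤? 5)) 5≤p))
... | inj₂ (inj₂ r²%24≡1) = p ^ 2 / 24 , (begin
  p ^ 2                         ≡⟨ m≡m%n+[m/n]*n (p ^ 2) 24 ⟩
  p ^ 2 % 24 + p ^ 2 / 24 * 24  ≡⟨ cong₂ _+_ p²%24≡1 (*-comm (p ^ 2 / 24) 24) ⟩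
  1 + 24 * (p ^ 2 / 24)         ∎)
  where
  open ≡-Reasoning
  p²%24≡1 : p ^ 2 % 24 ≡ 1
  p²%24≡1 = begin
    p * (p * 1) % 24             ≡⟨ cong (λ q → p * q % 24) (*-identityʳ p) ⟩
    p * p % 24                   ≡⟨ %-distribˡ-* p p 24 ⟩
    (p % 24) * (p % 24) % 24     ≡⟨ r²%24≡1 ⟩
    1                            ∎

[1+24t]^α≡1+24u : ∀ t α → ∃[ u ] (1 + 24 * t) ^ α ≡ 1 + 24 * u
[1+24t]^α≡1+24u t zero    = 0 , refl
[1+24t]^α≡1+24u t (suc α) with u , eq ← [1+24t]^α≡1+24u t α =
  t + u + 24 * t * u , trans (cong ((1 + 24 * t) *_) eq) (expand t u)
  where
  expand : ∀ t u → (1 + 24 * t) * (1 + 24 * u) ≡ 1 + 24 * (t + u + 24 * t * u)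
  expand = solve-∀

-- Descent on α: p divides x * x, hence x by Euclid's lemma, and p² cancels from both sides.
square-quotient : ∀ {p} → Prime p → ∀ α {m} x → x * x ≡ (p ^ 2) ^ α * m → ∃[ y ] y * y ≡ m
square-quotient     p-prime zero    {m} x eq = x , trans eq (+-identityʳ m)
square-quotient {p} p-prime (suc α) {m} x eq = square-quotient p-prime α (quotient p∣x) y²≡
  where
  instance _ = prime⇒nonZero p-prime
  regroup : ∀ p q m → p * (p * 1) * q * m ≡ q * m * p * p
  regroup = solve-∀
  x²≡ : x * x ≡ (p ^ 2) ^ α * m * p * p
  x²≡ = trans eq (regroup p ((p ^ 2) ^ α) m)
  p∣x : p ∣ x
  p∣x = reduce (euclidsLemma x x p-prime (divides ((p ^ 2) ^ α * m * p) x²≡))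
  swap : ∀ y p → y * y * p * p ≡ (y * p) * (y * p)
  swap = solve-∀
  y²≡ : quotient p∣x * quotient p∣x ≡ (p ^ 2) ^ α * m
  y²≡ = *-cancelʳ-≡ _ _ p (*-cancelʳ-≡ _ _ p (trans
    (swap (quotient p∣x) p)
    (trans (sym (cong₂ _*_ (_∣_.equality p∣x) (_∣_.equality p∣x))) x²≡)))

legendre≡-1⇒nonsquare : ∀ a p {{_ : Prime p}} → legendre a p ≡ -1ℤ → ¬ SquareMod p a
legendre≡-1⇒nonsquare a p {{p-prime}} eq with (+ p) ℤ.∣? a | squareMod? p {{prime⇒nonZero p-prime}} a
legendre≡-1⇒nonsquare a p () | yes _ | _
legendre≡-1⇒nonsquare a p () | no  _ | yes _
legendre≡-1⇒nonsquare a p eq | no  _ | no ¬sq = ¬sq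

square⇒SquareMod : ∀ p a k y → y * y ≡ k * p + a → SquareMod p (+ a)
square⇒SquareMod p a k y eq = + y , ℤ.divides (+ k) (begin
  + y ℤ.* + y ℤ.- + a           ≡⟨ cong (ℤ._- + a) (ℤ.pos-* y y) ⟨
  + (y * y) ℤ.- + a             ≡⟨ cong (λ z → + z ℤ.- + a) eq ⟩
  + (k * p + a) ℤ.- + a         ≡⟨ cong (ℤ._- + a) (trans (ℤ.pos-+ (k * p) a) (cong (ℤ._+ + a) (ℤ.pos-* k p))) ⟩
  + k ℤ.* + p ℤ.+ + a ℤ.- + a   ≡⟨ cancel (+ k ℤ.* + p) (+ a) ⟩
  + k ℤ.* + p                   ∎)
  where
  open ≡-Reasoning
  cancel : ∀ x y → x ℤ.+ y ℤ.- y ≡ x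
  cancel = ℤ-Solver.solve-∀

-- Since p^(2α) is 1 modulo 24, the numerator (24j+1)p^(2α) - 1 is a multiple of 24 and the division
-- is exact.
24N+1 : ∀ {p} → Prime p → 5 ≤ p → ∀ α n j →
  24 * (p ^ (2 * α + 1) * n + ((24 * j + 1) * p ^ (2 * α) ∸ 1) / 24) + 1
    ≡ (p ^ 2) ^ α * (24 * n * p + (24 * j + 1))
24N+1 {p} p-prime 5≤p α n j
  with t , p²≡ ← prime²≡1+24t p-prime 5≤p
  with u , P≡ ← [1+24t]^α≡1+24u t α = begin
  24 * (p ^ (2 * α + 1) * n + ((24 * j + 1) * p ^ (2 * α) ∸ 1) / 24) + 1
    ≡⟨ cong (λ z → 24 * (z * n + ((24 * j + 1) * p ^ (2 * α) ∸ 1) / 24) + 1) (^-distribˡ-+-* p (2 * α) 1) ⟩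
  24 * (p ^ (2 * α) * p ^ 1 * n + ((24 * j + 1) * p ^ (2 * α) ∸ 1) / 24) + 1
    ≡⟨ cong (λ z → 24 * (z * p ^ 1 * n + ((24 * j + 1) * z ∸ 1) / 24) + 1) P≡1+24u ⟩
  24 * ((1 + 24 * u) * (p * 1) * n + ((24 * j + 1) * (1 + 24 * u) ∸ 1) / 24) + 1
    -- `expand` puts a 1 in front, so that the truncated subtraction computes away and leaves an
    -- explicit multiple of 24.
    ≡⟨ cong (λ z → 24 * ((1 + 24 * u) * (p * 1) * n + (z ∸ 1) / 24) + 1) (expand j u) ⟩
  24 * ((1 + 24 * u) * (p * 1) * n + (j + u + 24 * j * u) * 24 / 24) + 1
    ≡⟨ cong (λ z → 24 * ((1 + 24 * u) * (p * 1) * n + z) + 1) (m*n/n≡m (j + u + 24 * j * u) 24) ⟩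
  24 * ((1 + 24 * u) * (p * 1) * n + (j + u + 24 * j * u)) + 1
    ≡⟨ collect p n j u ⟩
  (1 + 24 * u) * (24 * n * p + (24 * j + 1))
    ≡⟨ cong (_* (24 * n * p + (24 * j + 1))) (trans (cong (_^ α) p²≡) P≡) ⟨
  (p ^ 2) ^ α * (24 * n * p + (24 * j + 1)) ∎
  where
  open ≡-Reasoning
  P≡1+24u : p ^ (2 * α) ≡ 1 + 24 * u
  P≡1+24u = trans (sym (^-*-assoc p 2 α)) (trans (cong (_^ α) p²≡) P≡)
  expand : ∀ j u → (24 * j + 1) * (1 + 24 * u) ≡ 1 + (j + u + 24 * j * u) * 24
  expand = solve-∀
  collect : ∀ p n j u → 24 * ((1 + 24 * u) * (p * 1) * n + (j + u + 24 * j * u)) + 1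
                      ≡ (1 + 24 * u) * (24 * n * p + (24 * j + 1))
  collect = solve-∀

theorem3p3 : ∀ (p : ℕ) {{_ : Prime p}} → 5 ≤ p →
    ∀ (α n j : ℕ) → j ≤ p ∸ 1 → legendre (+ (24 * j + 1)) p ≡ -1ℤ →
    b 2 (p ^ (2 * α + 1) * n + ((24 * j + 1) * p ^ (2 * α) ∸ 1) / 24) % 2 ≡ 0
theorem3p3 p {{p-prime}} 5≤p α n j _ legendre≡-1 = b₂-even N λ x x²≡24N+1 →
  let y , y²≡ = square-quotient p-prime α x (trans x²≡24N+1 (24N+1 p-prime 5≤p α n j))
  -- Once p^(2α) is divided out, y² = 24n * p + (24j + 1), which makes 24j + 1 a square modulo p.
  in legendre≡-1⇒nonsquare (+ (24 * j + 1)) p legendre≡-1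
       (square⇒SquareMod p (24 * j + 1) (24 * n) y y²≡)
  where
  N = p ^ (2 * α + 1) * n + ((24 * j + 1) * p ^ (2 * α) ∸ 1) / 24
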